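{- For every integer $D\ge 1$ there exists $n_0$ such that for all $n\ge n_0$ the following holds. If $\Gamma$ is a graph that contains as a subgraph every $D$-degenerate graph on $n$ vertices with maximum degree at most $2D+1$, then \[e(\Gamma)\ge \tfrac{1}{1000D}\,n^{2-1/D}.\]
   Context: A graph $H$ is $D$-degenerate if every induced subgraph of $H$ has a vertex of degree at most $D$; equivalently, there is an ordering $v_1,\dots,v_n$ of $V(H)$ such that each $v_i$ has at most $D$ neighbours among $v_1,\dots,v_{i-1}$. $e(\Gamma)$ denotes the number of edges of $\Gamma$. -}

module Defs where

open import Data.Fin.Base using (Fin; _<_)
open import Data.Fin.Properties using (_<?_)
open import Data.Fin.Subset using (Subset; Nonempty; _∈_; _∩_; ∣_∣)
open import Data.List.Base using (allFin; cartesianProduct; filter; length)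
open import Data.Nat.Base using (ℕ; NonZero; _≤_; _^_)
open import Data.Product.Base using (_×_; _,_; ∃-syntax)
open import Data.Vec.Base using (tabulate)
open import Function.Definitions using (Injective)
open import Level using (0ℓ)
open import Relation.Binary.Core using (Rel)
open import Relation.Binary.Definitions using (Decidable; Irreflexive; Symmetric)
open import Relation.Binary.PropositionalEquality.Core using (_≡_)
open import Relation.Nullary.Decidable using (does; _×-dec_)

record Graph (n : ℕ) : Set₁ where
  infix 4 _~_ _~?_
  field
    _~_    : Rel (Fin n) 0ℓ
    _~?_   : Decidable _~_
    sym    : Symmetric _~_
    irrefl : Irreflexive _≡_ _~_

  neighbours : Fin n → Subset n
  neighbours u = tabulate (λ v → does (u ~? v))

  degree : Fin n → ℕ
  degree u = ∣ neighbours u ∣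

  -- For u ∈ S this is the degree of u in the subgraph induced on S.
  degreeIn : Subset n → Fin n → ℕ
  degreeIn S u = ∣ neighbours u ∩ S ∣

  -- Each edge {u , v} is counted once, as the pair with u < v.
  edgeCount : ℕ
  edgeCount = length (filter (λ (u , v) → (u <? v) ×-dec (u ~? v))
                             (cartesianProduct (allFin n) (allFin n)))

open Graph using (degree; degreeIn; edgeCount) public

-- The empty induced subgraph has no vertices at all and is excluded.
Degenerate : ℕ → ∀ {n} → Graph n → Set
Degenerate D {n} H =
  ∀ (S : Subset n) → Nonempty S → ∃[ v ] (v ∈ S × degreeIn H S v ≤ D)

MaxDegree≤ : ℕ → ∀ {n} → Graph n → Set
MaxDegree≤ k H = ∀ v → degree H v ≤ k

-- Not necessarily induced: non-edges of H may be mapped to edges of Γ.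
_⊆ᴳ_ : ∀ {n m} → Graph n → Graph m → Set
_⊆ᴳ_ {n} {m} H Γ =
  ∃[ f ] (Injective _≡_ _≡_ f × (∀ {u v : Fin n} → u H.~ v → f u Γ.~ f v))
  where
  module H = Graph H
  module Γ = Graph Γ

-- n ^[ p / q ]≤ x is the inequality n^(p/q) ≤ x, where n^(p/q) is the
-- nonnegative real q-th root of n^p; as q ≥ 1 and t ↦ t^q is increasing on
-- nonnegative reals, comparing with a natural number x needs no real numbers.
_^[_/_]≤_ : (n p q : ℕ) .{{_ : NonZero q}} → ℕ → Set
(n ^[ p / q ]≤ x) = n ^ p ≤ x ^ q

{-# OPTIONS --safe #-}
module Submission where

-- Consider the graphs formed by the path 0, 1, …, T in which every vertex
-- t + 1 also picks D − 1 of the vertices 0, …, t, no vertex being picked more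
-- than D times. If every vertex offers D slots, then each pick of t + 1 finds
-- at least t + 1 free slots, so there are (T!)^(D − 1) ways to choose slots.
-- Conversely, given an embedding f in Γ, the vertices f 1, …, f T can be read
-- off in turn from the position of each in the neighbourhood of its
-- predecessor on the path, and the picked vertices from their positions in the
-- neighbourhoods of f 1, …, f T. Since degrees of distinct vertices of Γ sum
-- to at most 2e(Γ), there are at most about (e(Γ)/T)^(D T) such codes, up to a
-- factor D^((D − 1) T) for the slots and a factor exponential in D T.

open import Data.Bool.Base using (Bool; true; false)
open import Data.Fin.Base as Fin
  using (Fin; zero; suc; toℕ; fromℕ<; inject₁; opposite; punchIn; punchOut;
         combine; quotient; remainder; finToFun; funToFin; splitAt; join)
open import Data.Fin.Properties as Fin
  using (toℕ<n; toℕ-injective; toℕ-fromℕ; toℕ-fromℕ<; fromℕ<-injective;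
         toℕ-inject₁; inject₁-injective; opposite-involutive; splitAt-join;
         punchIn-punchOut; punchOut-injective; injective⇒≤;
         toℕ-combine; combine-injective; combine-remQuot; remQuot-combine;
         funToFin-finToFin; finToFun-funToFin)
open import Data.Fin.Subset using (Subset; Nonempty; inside; outside; _∈_; _∩_; ∣_∣)
open import Data.Fin.Subset.Properties using (x∈p∩q⁻; nonempty?)
open import Data.List.Base as List using (cartesianProduct; filter; length)
open import Data.List.Properties using (map-tabulate; filter-++; length-++)
open import Data.Nat.Base
open import Data.Nat.DivMod
open import Data.Nat.Properties
open import Data.Nat.Tactic.RingSolver using (solve-∀)
open import Data.Product.Base using (_×_; _,_; proj₁; proj₂; ∃-syntax)
open import Data.Sum.Base as Sum using (_⊎_; inj₁; inj₂)
open import Data.Sum.Properties using (inj₁-injective; inj₂-injective)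
open import Data.Vec.Base as Vec using (_∷_; here; there)
open import Data.Vec.Properties using (lookup∘tabulate; []=⇒lookup)
open import Function.Base using (_∘_; id)
open import Function.Bundles using (mk⇔)
open import Function.Definitions using (Injective)
open import Relation.Binary.Definitions using (tri<; tri≈; tri>)
open import Relation.Binary.PropositionalEquality
open import Relation.Nullary.Decidable
  using (Dec; yes; no; does; dec-true; dec-false; does-⇔; map′; _⊎-dec_; _×-dec_)
open import Relation.Nullary.Negation using (¬_; contradiction)
import Relation.Binary.Definitions as Binary
import Relation.Unary as Unary

open import Algebra.Properties.CommutativeMonoid.Sum *-1-commutativeMonoid
  using () renaming (sum to product)
open import Algebra.Properties.CommutativeSemigroup *-commutativeSemigroup
  using (x∙yz≈y∙xz)
open import Algebra.Properties.Semiring.Sum +-*-semiring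
  using (sum; sum-cong-≗; sum-remove; ∑-distrib-+; ∑-comm; *-distribʳ-sum)

open import Defs

private variable
  k m n : ℕ

-- Bounding the size of a subset by labels.

elements : (p : Subset n) → Fin ∣ p ∣ → Fin n
elements (inside  ∷ p) zero    = zero
elements (inside  ∷ p) (suc i) = suc (elements p i)
elements (outside ∷ p) i       = suc (elements p i)

elements-∈ : (p : Subset n) (i : Fin ∣ p ∣) → elements p i ∈ p
elements-∈ (inside  ∷ p) zero    = here
elements-∈ (inside  ∷ p) (suc i) = there (elements-∈ p i)
elements-∈ (outside ∷ p) i       = there (elements-∈ p i)

elements-injective : (p : Subset n) → Injective _≡_ _≡_ (elements p)
elements-injective (inside  ∷ p) {zero}  {zero}  _  = refl
elements-injective (inside  ∷ p) {suc i} {suc j} eq =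
  cong suc (elements-injective p (Fin.suc-injective eq))
elements-injective (outside ∷ p) eq = elements-injective p (Fin.suc-injective eq)

-- The label may depend on the proof of membership. For neighbourhoods it is read off from the way
-- in which an edge arises, and an edge may arise in several ways.
∣p∣≤-labels : (p : Subset n) (label : ∀ {i} → i ∈ p → Fin k) →
  (∀ {i j} (i∈p : i ∈ p) (j∈p : j ∈ p) → label i∈p ≡ label j∈p → i ≡ j) →
  ∣ p ∣ ≤ k
∣p∣≤-labels p label label-injective = injective⇒≤ λ eq →
  elements-injective p (label-injective (elements-∈ p _) (elements-∈ p _) eq)

-- Indicator sums, sums along injections, prefix sums.

𝟙 : Bool → ℕ
𝟙 true  = 1
𝟙 false = 0

𝟙-positive : ∀ {a} {P : Set a} (P? : Dec P) → P → 0 < 𝟙 (does P?)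
𝟙-positive P? p rewrite dec-true P? p = z<s

∣tabulate∣ : (f : Fin n → Bool) → ∣ Vec.tabulate f ∣ ≡ sum (𝟙 ∘ f)
∣tabulate∣ {zero}  f = refl
∣tabulate∣ {suc n} f with f zero
... | true  = cong suc (∣tabulate∣ (f ∘ suc))
... | false = ∣tabulate∣ (f ∘ suc)

module _ {a ℓ} {A : Set a} {P : Unary.Pred A ℓ} (P? : Unary.Decidable P) where

  length-filter-tabulate : (f : Fin n → A) →
    length (filter P? (List.tabulate f)) ≡ sum (λ i → 𝟙 (does (P? (f i))))
  length-filter-tabulate {zero}  f = refl
  length-filter-tabulate {suc n} f with does (P? (f zero))
  ... | true  = cong suc (length-filter-tabulate (f ∘ suc))
  ... | false = length-filter-tabulate (f ∘ suc)

module _ {a b ℓ} {A : Set a} {B : Set b} {P : Unary.Pred (A × B) ℓ} (P? : Unary.Decidable P) where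

  length-filter-cartesianProduct : (f : Fin m → A) (g : Fin n → B) →
    length (filter P? (cartesianProduct (List.tabulate f) (List.tabulate g))) ≡
    sum (λ i → sum (λ j → 𝟙 (does (P? (f i , g j)))))
  length-filter-cartesianProduct {zero}  f g = refl
  length-filter-cartesianProduct {suc m} f g = begin
    length (filter P? (row List.++ rest))
      ≡⟨ cong length (filter-++ P? row rest) ⟩
    length (filter P? row List.++ filter P? rest)
      ≡⟨ length-++ (filter P? row) ⟩
    length (filter P? row) + length (filter P? rest)
      ≡⟨ cong₂ _+_
           (trans (cong (length ∘ filter P?) (map-tabulate g (f zero ,_)))
                  (length-filter-tabulate P? (λ j → f zero , g j)))
           (length-filter-cartesianProduct (f ∘ suc) g) ⟩
    sum (λ i → sum (λ j → 𝟙 (does (P? (f i , g j))))) ∎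
    where
    open ≡-Reasoning
    row  = List.map (f zero ,_) (List.tabulate g)
    rest = cartesianProduct (List.tabulate (f ∘ suc)) (List.tabulate g)

sum-mono-≤ : {v w : Fin n → ℕ} → (∀ i → v i ≤ w i) → sum v ≤ sum w
sum-mono-≤ {zero}  v≤w = z≤n
sum-mono-≤ {suc n} v≤w = +-mono-≤ (v≤w zero) (sum-mono-≤ (v≤w ∘ suc))

n≤sum : (w : Fin n → ℕ) → (∀ i → 0 < w i) → n ≤ sum w
n≤sum {zero}  w 0<w = z≤n
n≤sum {suc n} w 0<w = +-mono-≤ (0<w zero) (n≤sum (w ∘ suc) (0<w ∘ suc))

-- By injectivity `f ∘ suc` avoids `f zero` and so factors through `punchIn (f zero)`; the induction
-- continues with that weight removed.
sum-injection-≤ : (w : Fin m → ℕ) (f : Fin n → Fin m) → Injective _≡_ _≡_ f →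
  sum (w ∘ f) ≤ sum w
sum-injection-≤ {n = zero} w f inj = z≤n
sum-injection-≤ {m = zero} {n = suc n} w f inj with () ← f zero
sum-injection-≤ {m = suc m} {n = suc n} w f inj = begin
  w (f zero) + sum (w ∘ f ∘ suc)
    ≡⟨ cong (w (f zero) +_) (sum-cong-≗ λ j → cong w (sym (punchIn-punchOut (f0≢ j)))) ⟩
  w (f zero) + sum (w ∘ punchIn (f zero) ∘ g)
    ≤⟨ +-monoʳ-≤ (w (f zero)) (sum-injection-≤ (w ∘ punchIn (f zero)) g g-injective) ⟩
  w (f zero) + sum (w ∘ punchIn (f zero))
    ≡⟨ sum-remove w ⟨
  sum w ∎
  where
  open ≤-Reasoning
  f0≢ : ∀ j → f zero ≢ f (suc j)
  f0≢ j eq = Fin.0≢1+n (inj eq)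
  g : Fin n → Fin m
  g j = punchOut (f0≢ j)
  g-injective : Injective _≡_ _≡_ g
  g-injective eq = Fin.suc-injective (inj (punchOut-injective (f0≢ _) (f0≢ _) eq))

-- This numbering serves twice. On a row of the adjacency matrix it gives the position of a
-- neighbour, which is below the degree; on the degree sequence it names a non-isolated vertex by a
-- number below twice the edge count.
before : (Fin n → ℕ) → Fin n → ℕ
before w zero    = 0
before w (suc i) = w zero + before (w ∘ suc) i

before-< : (w : Fin n → ℕ) (i : Fin n) → 0 < w i → before w i < sum w
before-< w zero    0<wᵢ = ≤-trans 0<wᵢ (m≤m+n _ _)
before-< w (suc i) 0<wᵢ = +-monoʳ-< (w zero) (before-< (w ∘ suc) i 0<wᵢ)

-- If `i` and `j` differ, the positive weight at the smaller index enters only the prefix sum of the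
-- larger one.
before-injective : (w : Fin n → ℕ) {i j : Fin n} → 0 < w i → 0 < w j →
  before w i ≡ before w j → i ≡ j
before-injective w {zero}  {zero}  _ _ _ = refl
before-injective w {zero}  {suc j} 0<wᵢ _ eq =
  contradiction eq (<⇒≢ (≤-trans 0<wᵢ (m≤m+n _ _)))
before-injective w {suc i} {zero}  _ 0<wⱼ eq =
  contradiction (sym eq) (<⇒≢ (≤-trans 0<wⱼ (m≤m+n _ _)))
before-injective w {suc i} {suc j} 0<wᵢ 0<wⱼ eq =
  cong suc (before-injective (w ∘ suc) 0<wᵢ 0<wⱼ (+-cancelˡ-≡ (w zero) _ _ eq))

-- The handshake identity.

module _ (Γ : Graph m) where

  open Graph Γ using (_~_; _~?_; irrefl) renaming (sym to ~-sym)

  adjacency : Fin m → Fin m → ℕ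
  adjacency x y = 𝟙 (does (x ~? y))

  degree≡sum : ∀ x → degree Γ x ≡ sum (adjacency x)
  degree≡sum x = ∣tabulate∣ (λ y → does (x ~? y))

  private
    edge : Fin m → Fin m → ℕ
    edge x y = 𝟙 (does ((x Fin.<? y) ×-dec (x ~? y)))

    adjacency-split : ∀ x y → adjacency x y ≡ edge x y + edge y x
    adjacency-split x y with Fin.<-cmp x y
    ... | tri< x<y _ y≮x
      rewrite dec-true (x Fin.<? y) x<y | dec-false (y Fin.<? x) y≮x = sym (+-identityʳ _)
    ... | tri≈ x≮y x≡y y≮x
      rewrite dec-false (x Fin.<? y) x≮y | dec-false (y Fin.<? x) y≮x
            | dec-false (x ~? y) (irrefl x≡y) = refl
    ... | tri> x≮y _ y<x
      rewrite dec-false (x Fin.<? y) x≮y | dec-true (y Fin.<? x) y<x =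
      cong 𝟙 (does-⇔ (mk⇔ ~-sym ~-sym) (x ~? y) (y ~? x))

  handshake : sum (degree Γ) ≡ edgeCount Γ + edgeCount Γ
  handshake = begin
    sum (degree Γ)
      ≡⟨ sum-cong-≗ degree≡sum ⟩
    sum (λ x → sum (adjacency x))
      ≡⟨ sum-cong-≗ (λ x → trans (sum-cong-≗ (adjacency-split x)) (∑-distrib-+ (edge x) _)) ⟩
    sum (λ x → sum (edge x) + sum (λ y → edge y x))
      ≡⟨ ∑-distrib-+ (λ x → sum (edge x)) _ ⟩
    sum (λ x → sum (edge x)) + sum (λ x → sum (λ y → edge y x))
      ≡⟨ cong (sum (λ x → sum (edge x)) +_) (∑-comm (λ x y → edge y x)) ⟩
    sum (λ x → sum (edge x)) + sum (λ x → sum (edge x))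
      ≡⟨ cong₂ _+_ edges edges ⟨
    edgeCount Γ + edgeCount Γ ∎
    where
    open ≡-Reasoning
    edges = length-filter-cartesianProduct (λ (u , v) → (u Fin.<? v) ×-dec (u ~? v)) id id

-- Mixed radix numerals.

mixedRadix : (radix digit : Fin n → ℕ) → ℕ
mixedRadix {zero}  radix digit = 0
mixedRadix {suc n} radix digit =
  digit zero + radix zero * mixedRadix (radix ∘ suc) (digit ∘ suc)

digit-+-radix-* : ∀ a b x {r} → a < r → x < b → a + r * x < r * b
digit-+-radix-* a b x {r} a<r x<b = begin-strict
  a + r * x  <⟨ +-monoˡ-< (r * x) a<r ⟩
  r + r * x  ≡⟨ *-suc r x ⟨
  r * suc x  ≤⟨ *-monoʳ-≤ r x<b ⟩
  r * b      ∎
  where open ≤-Reasoning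

mixedRadix-< : (radix digit : Fin n → ℕ) → (∀ i → digit i < radix i) →
  mixedRadix radix digit < product radix
mixedRadix-< {zero}  r a a<r = z<s
mixedRadix-< {suc n} r a a<r =
  digit-+-radix-* (a zero) _ _ (a<r zero) (mixedRadix-< (r ∘ suc) (a ∘ suc) (a<r ∘ suc))

-- Reduction modulo the common radix isolates the lowest digit. Only this one radix has to agree,
-- which allows later radices to depend on digits already decoded.
leading-digit : ∀ {a b r s x y} → r ≡ s → a < r → b < s →
  a + r * x ≡ b + s * y → a ≡ b × x ≡ y
leading-digit {a} {b} {r} {.r} {x} {y} refl a<r b<r eq =
  a≡b , *-cancelˡ-≡ x y r (+-cancelˡ-≡ b _ _ (trans (cong (_+ r * x) (sym a≡b)) eq))
  where
  open ≡-Reasoning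
  instance
    r≢0 : NonZero r
    r≢0 = >-nonZero (≤-<-trans z≤n a<r)
  lowest : ∀ c z → c < r → (c + r * z) % r ≡ c
  lowest c z c<r = begin
    (c + r * z) % r ≡⟨ cong (λ - → (c + -) % r) (*-comm r z) ⟩
    (c + z * r) % r ≡⟨ [m+kn]%n≡m%n c z r ⟩
    c % r           ≡⟨ m<n⇒m%n≡m c<r ⟩
    c               ∎
  a≡b : a ≡ b
  a≡b = trans (sym (lowest a x a<r)) (trans (cong (_% r) eq) (lowest b y b<r))

mixedRadix-injective : {r s a b : Fin n → ℕ} → r ≗ s →
  (∀ i → a i < r i) → (∀ i → b i < s i) →
  mixedRadix r a ≡ mixedRadix s b → a ≗ b
mixedRadix-injective {suc n} r≗s a<r b<s eq
  with eq₀ , eq₊ ← leading-digit (r≗s zero) (a<r zero) (b<s zero) eq = λ where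
    zero    → eq₀
    (suc i) → mixedRadix-injective (r≗s ∘ suc) (a<r ∘ suc) (b<s ∘ suc) eq₊ i

-- Bounding a product in terms of the sum of its factors.

n<2^n : ∀ n → n < 2 ^ n
n<2^n zero    = z<s
n<2^n (suc n) = begin-strict
  1 + n         <⟨ +-mono-≤-< (m^n>0 2 n) (n<2^n n) ⟩
  2 ^ n + 2 ^ n ≡⟨ cong (2 ^ n +_) (+-identityʳ (2 ^ n)) ⟨
  2 ^ suc n     ∎
  where open ≤-Reasoning

product≤ : (w : Fin n → ℕ) (b : ℕ) .{{_ : NonZero b}} →
  product w ≤ b ^ n * 2 ^ sum (λ i → w i / b)
product≤ {zero}  w b = ≤-refl
product≤ {suc n} w b = begin
  w zero * product (w ∘ suc)
    ≤⟨ *-mono-≤ w₀≤ (product≤ (w ∘ suc) b) ⟩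
  (b * 2 ^ (w zero / b)) * (b ^ n * 2 ^ rest)
    ≡⟨ [m*n]*[o*p]≡[m*o]*[n*p] b _ (b ^ n) _ ⟩
  b ^ suc n * (2 ^ (w zero / b) * 2 ^ rest)
    ≡⟨ cong (b ^ suc n *_) (^-distribˡ-+-* 2 (w zero / b) rest) ⟨
  b ^ suc n * 2 ^ sum (λ i → w i / b) ∎
  where
  open ≤-Reasoning
  rest = sum (λ i → w (suc i) / b)
  w₀≤ : w zero ≤ b * 2 ^ (w zero / b)
  w₀≤ = begin
    w zero                            ≡⟨ m≡m%n+[m/n]*n (w zero) b ⟩
    w zero % b + w zero / b * b       ≤⟨ +-monoˡ-≤ _ (m%n≤n (w zero) b) ⟩
    b + w zero / b * b                ≡⟨ *-comm (suc (w zero / b)) b ⟩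
    b * suc (w zero / b)              ≤⟨ *-monoʳ-≤ b (n<2^n (w zero / b)) ⟩
    b * 2 ^ (w zero / b)              ∎

-- In place of the AM–GM inequality: every factor a is at most b * 2 ^ (a / b).
product≤-of-sum≤ : (w : Fin n → ℕ) (b : ℕ) .{{_ : NonZero b}} →
  sum w ≤ m * b → product w ≤ b ^ n * 2 ^ m
product≤-of-sum≤ {n} {m} w b sum≤ = begin
  product w                           ≤⟨ product≤ w b ⟩
  b ^ n * 2 ^ sum (λ i → w i / b)     ≤⟨ *-monoʳ-≤ (b ^ n) (^-monoʳ-≤ 2 quotients≤) ⟩
  b ^ n * 2 ^ m                       ∎
  where
  open ≤-Reasoning
  quotients≤ : sum (λ i → w i / b) ≤ m
  quotients≤ = *-cancelʳ-≤ _ m b (begin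
    sum (λ i → w i / b) * b   ≡⟨ *-distribʳ-sum b (λ i → w i / b) ⟩
    sum (λ i → w i / b * b)   ≤⟨ sum-mono-≤ (λ i → m/n*n≤m (w i) b) ⟩
    sum w                     ≤⟨ sum≤ ⟩
    m * b                     ∎)

-- Swaps and the shuffle that lists the used slots.

swap : ℕ → ℕ → ℕ → ℕ
swap a b x with x ≟ a | x ≟ b
... | yes _ | _     = b
... | no _  | yes _ = a
... | no _  | no _  = x

swap-left : ∀ a b → swap a b a ≡ b
swap-left a b with a ≟ a
... | yes _  = refl
... | no a≢a = contradiction refl a≢a

swap-right : ∀ a b → swap a b b ≡ a
swap-right a b with b ≟ a | b ≟ b
... | yes b≡a | _      = b≡a
... | no _    | yes _  = refl
... | no _    | no b≢b = contradiction refl b≢b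

swap-involutive : ∀ a b x → swap a b (swap a b x) ≡ x
swap-involutive a b x with x ≟ a | x ≟ b
... | yes refl | _        = swap-right x b
... | no _     | yes refl = swap-left a x
... | no x≢a   | no x≢b with x ≟ a | x ≟ b
... | yes x≡a | _       = contradiction x≡a x≢a
... | no _    | yes x≡b = contradiction x≡b x≢b
... | no _    | no _    = refl

swap-injective : ∀ a b → Injective _≡_ _≡_ (swap a b)
swap-injective a b {x} {y} eq =
  trans (sym (swap-involutive a b x)) (trans (cong (swap a b) eq) (swap-involutive a b y))

swap-preserves : ∀ {p} (P : ℕ → Set p) {a b x} → P a → P b → P x → P (swap a b x)
swap-preserves P {a} {b} {x} pa pb px with x ≟ a | x ≟ b
... | yes _ | _     = pb
... | no _  | yes _ = pa
... | no _  | no _  = px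

-- The Fisher–Yates shuffle of k, k + 1, …, which at step i swaps the entries at
-- k + i and c i; the result lists the final entries at k, …, k + n − 1.
shuffle : ℕ → (Fin n → ℕ) → Fin n → ℕ
shuffle k c zero    = c zero
shuffle k c (suc i) = swap k (c zero) (shuffle (suc k) (c ∘ suc) i)

private
  shift : {c : Fin (suc n) → ℕ} → (∀ i → k + toℕ i ≤ c i) → ∀ i → suc k + toℕ i ≤ c (suc i)
  shift {k = k} {c = c} k+i≤c i = subst (_≤ c (suc i)) (+-suc k (toℕ i)) (k+i≤c (suc i))

  start : {c : Fin (suc n) → ℕ} → (∀ i → k + toℕ i ≤ c i) → k ≤ c zero
  start {k = k} {c = c} k+i≤c = subst (_≤ c zero) (+-identityʳ k) (k+i≤c zero)

shuffle-≥ : (c : Fin n → ℕ) → (∀ i → k + toℕ i ≤ c i) → ∀ i → k ≤ shuffle k c i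
shuffle-≥ {suc n} {k} c k+i≤c zero    = start {c = c} k+i≤c
shuffle-≥ {suc n} {k} c k+i≤c (suc i) =
  swap-preserves (k ≤_) ≤-refl (start {c = c} k+i≤c)
    (<⇒≤ (shuffle-≥ (c ∘ suc) (shift {c = c} k+i≤c) i))

-- Since `k ≤ c zero < bound zero` and the bounds are monotone, both numbers exchanged by the first
-- swap lie below every later bound.
shuffle-< : (c bound : Fin n → ℕ) → (∀ i → k + toℕ i ≤ c i) → (∀ i → c i < bound i) →
  (∀ {i j} → toℕ i ≤ toℕ j → bound i ≤ bound j) → ∀ i → shuffle k c i < bound i
shuffle-< {suc n} c bound k+i≤c c<bound mono zero    = c<bound zero
shuffle-< {suc n} c bound k+i≤c c<bound mono (suc i) =
  swap-preserves (_< bound (suc i))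
    (≤-<-trans (start {c = c} k+i≤c) c₀<)
    c₀<
    (shuffle-< (c ∘ suc) (bound ∘ suc) (shift {c = c} k+i≤c) (c<bound ∘ suc) (mono ∘ s≤s) i)
  where c₀< = <-≤-trans (c<bound zero) (mono z≤n)

-- Before the first swap is applied, the later entries are at least `suc k`. So none of them is `k`,
-- the only number that the swap sends to `c zero`.
shuffle-injective : (c : Fin n → ℕ) → (∀ i → k + toℕ i ≤ c i) →
  Injective _≡_ _≡_ (shuffle k c)
shuffle-injective {suc n} c k+i≤c {zero}  {zero}  eq = refl
shuffle-injective {suc n} {k} c k+i≤c {zero}  {suc j} eq =
  contradiction (swap-injective k (c zero) (trans (swap-left k (c zero)) eq))
    (<⇒≢ (shuffle-≥ (c ∘ suc) (shift {c = c} k+i≤c) j))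
shuffle-injective {suc n} {k} c k+i≤c {suc i} {zero}  eq =
  contradiction (swap-injective k (c zero) (trans (swap-left k (c zero)) (sym eq)))
    (<⇒≢ (shuffle-≥ (c ∘ suc) (shift {c = c} k+i≤c) i))
shuffle-injective {suc n} {k} c k+i≤c {suc i} {suc j} eq =
  cong suc (shuffle-injective (c ∘ suc) (shift {c = c} k+i≤c) (swap-injective k (c zero) eq))

-- The first entry reveals which swap was made; undoing it exposes the shuffle of the remaining
-- steps.
shuffle-determines : (b c : Fin n → ℕ) → shuffle k b ≗ shuffle k c → b ≗ c
shuffle-determines {suc n}     b c eq zero    = eq zero
shuffle-determines {suc n} {k} b c eq (suc i) =
  shuffle-determines (b ∘ suc) (c ∘ suc) (λ j → swap-injective k (c zero)
    (trans (cong (λ - → swap k - (shuffle (suc k) (b ∘ suc) j)) (sym (eq zero))) (eq (suc j)))) i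

-- Digits of numbers below products, powers and factorials.

remQuot-injective : ∀ n {i j : Fin (m * n)} →
  quotient {m} n i ≡ quotient n j → remainder {m} n i ≡ remainder {m} n j → i ≡ j
remQuot-injective {m} n {i} {j} eq₁ eq₂ = begin
  i                                                   ≡⟨ combine-remQuot {m} n i ⟨
  combine (quotient {m} n i) (remainder {m} n i)      ≡⟨ cong₂ combine eq₁ eq₂ ⟩
  combine (quotient {m} n j) (remainder {m} n j)      ≡⟨ combine-remQuot {m} n j ⟩
  j                                                   ∎
  where open ≡-Reasoning

finToFun-injective : {i j : Fin (m ^ n)} → finToFun {m} {n} i ≗ finToFun j → i ≡ j
finToFun-injective {m} {n} {i} {j} eq =
  trans (sym (funToFin-finToFin {n} {m} i))
    (trans (funToFin-cong eq) (funToFin-finToFin {n} {m} j))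
  where
  funToFin-cong : ∀ {n m} {f g : Fin n → Fin m} → f ≗ g → funToFin f ≡ funToFin g
  funToFin-cong {zero}  eq = refl
  funToFin-cong {suc n} eq = cong₂ combine (eq zero) (funToFin-cong (eq ∘ suc))

-- The factorial number system, widest digit first because `suc n !` unfolds to `suc n * n !`. Digit
-- `i` therefore has `n - i` values.
factorialDigit : Fin (n !) → Fin n → ℕ
factorialDigit {suc n} x zero    = toℕ (quotient {suc n} (n !) x)
factorialDigit {suc n} x (suc i) = factorialDigit (remainder {suc n} (n !) x) i

factorialDigit-≤ : (x : Fin (n !)) (i : Fin n) → factorialDigit x i ≤ toℕ (opposite i)
factorialDigit-≤ {suc n} x zero    =
  subst (toℕ (quotient {suc n} (n !) x) ≤_) (sym (toℕ-fromℕ n))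
    (s≤s⁻¹ (toℕ<n (quotient {suc n} (n !) x)))
factorialDigit-≤ {suc n} x (suc i) =
  subst (factorialDigit (remainder {suc n} (n !) x) i ≤_) (sym (toℕ-inject₁ (opposite i)))
    (factorialDigit-≤ (remainder {suc n} (n !) x) i)

factorialDigit-injective : {x y : Fin (n !)} → factorialDigit {n} x ≗ factorialDigit y → x ≡ y
factorialDigit-injective {zero}  {zero} {zero} _ = refl
factorialDigit-injective {suc n} {x} {y} eq =
  remQuot-injective {suc n} (n !) (toℕ-injective (eq zero)) (factorialDigit-injective {n} (eq ∘ suc))

-- A lower bound for the factorial.

n!*n^k≤[n+k]! : ∀ n k → n ! * n ^ k ≤ (k + n) !
n!*n^k≤[n+k]! n zero    = ≤-reflexive (*-identityʳ (n !))
n!*n^k≤[n+k]! n (suc k) = begin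
  n ! * (n * n ^ k)     ≡⟨ x∙yz≈y∙xz (n !) n (n ^ k) ⟩
  n * (n ! * n ^ k)     ≤⟨ *-mono-≤ (m≤n+m n (suc k)) (n!*n^k≤[n+k]! n k) ⟩
  (suc k + n) * (k + n) ! ∎
  where
  open ≤-Reasoning

-- The central binomial coefficient is at most `4 ^ n`: passing to `suc n` multiplies the left side
-- by (2n + 2)(2n + 1), which is at most 4(n + 1)².
[n+n]!≤4^n*n!*n! : ∀ n → (n + n) ! ≤ 4 ^ n * (n ! * n !)
[n+n]!≤4^n*n!*n! zero    = ≤-refl
[n+n]!≤4^n*n!*n! (suc n) = begin
  suc (n + suc n) * (n + suc n) !
    ≡⟨ cong (λ - → suc - * - !) (+-suc n n) ⟩
  (2 + (n + n)) * ((1 + (n + n)) * (n + n) !)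
    ≤⟨ *-monoʳ-≤ (2 + (n + n)) (*-mono-≤ (n≤1+n (1 + (n + n))) ([n+n]!≤4^n*n!*n! n)) ⟩
  (2 + (n + n)) * ((2 + (n + n)) * (4 ^ n * (n ! * n !)))
    ≡⟨ regroup n (4 ^ n) (n !) ⟩
  4 ^ suc n * (suc n ! * suc n !) ∎
  where
  open ≤-Reasoning
  regroup : ∀ n p f → (2 + (n + n)) * ((2 + (n + n)) * (p * (f * f))) ≡
                      4 * p * (suc n * f * (suc n * f))
  regroup = solve-∀

-- A weak form of Stirling's bound, obtained by estimating `(n + n) !` from both sides and
-- cancelling `n !`.
n^n≤4^n*n! : ∀ n → n ^ n ≤ 4 ^ n * n !
n^n≤4^n*n! n = *-cancelˡ-≤ (n !) {{n !≢0}} (begin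
  n ! * n ^ n          ≤⟨ n!*n^k≤[n+k]! n n ⟩
  (n + n) !            ≤⟨ [n+n]!≤4^n*n!*n! n ⟩
  4 ^ n * (n ! * n !)  ≡⟨ x∙yz≈y∙xz (4 ^ n) (n !) (n !) ⟩
  n ! * (4 ^ n * n !)  ∎)
  where
  open ≤-Reasoning

-- Paths with additional arcs: degeneracy and maximum degree.

maximum : (S : Subset n) → Nonempty S → ∃[ v ] (v ∈ S × (∀ {u} → u ∈ S → toℕ u ≤ toℕ v))
maximum (b ∷ S) (i , i∈S) with nonempty? S
... | yes ne = let v , v∈S , v-max = maximum S ne in
  suc v , there v∈S , λ { here → z≤n ; (there u∈S) → s≤s (v-max u∈S) }
maximum (b ∷ S) (zero  , here)      | no empty =
  zero , here , λ { here → z≤n ; (there u∈S) → contradiction (_ , u∈S) empty }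
maximum (b ∷ S) (suc i , there i∈S) | no empty = contradiction (i , i∈S) empty

∈-neighbours⁻ : (Γ : Graph n) → ∀ {u v} → v ∈ Graph.neighbours Γ u → Graph._~_ Γ u v
∈-neighbours⁻ Γ {u} {v} v∈ with Graph._~?_ Γ u v | trans (sym (lookup∘tabulate _ v)) ([]=⇒lookup v∈)
... | yes u~v | _ = u~v

-- The labels encode degree bounds: at most `K` arcs leave a vertex and at most `D` enter it.
module PathWithArcs {T K D Q : ℕ}
  (source target : Fin Q → Fin (suc T))
  (target<source : ∀ q → target q Fin.< source q)
  (outLabel : Fin Q → Fin K)
  (outLabel-injective : ∀ {p q} → source p ≡ source q → outLabel p ≡ outLabel q → p ≡ q)
  (inLabel : Fin Q → Fin D)
  (inLabel-injective : ∀ {p q} → target p ≡ target q → inLabel p ≡ inLabel q → p ≡ q)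
  where

  -- Arcs may be parallel to each other or to a path edge, so one pair can have several proofs. The
  -- labels below determine the other endpoint whichever proofs are compared.
  data Back (u v : Fin (suc T)) : Set where
    step : suc (toℕ u) ≡ toℕ v → Back u v
    arc  : ∀ q → target q ≡ u → source q ≡ v → Back u v

  Back? : Binary.Decidable Back
  Back? u v = map′
    (λ { (inj₁ eq) → step eq ; (inj₂ (q , eq₁ , eq₂)) → arc q eq₁ eq₂ })
    (λ { (step eq) → inj₁ eq ; (arc q eq₁ eq₂) → inj₂ (q , eq₁ , eq₂) })
    ((suc (toℕ u) ≟ toℕ v) ⊎-dec
     Fin.any? (λ q → (target q Fin.≟ u) ×-dec (source q Fin.≟ v)))

  Back⇒< : ∀ {u v} → Back u v → u Fin.< v
  Back⇒< (step eq)        = ≤-reflexive eq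
  Back⇒< (arc q refl refl) = target<source q

  pathWithArcs : Graph (suc T)
  pathWithArcs = record
    { _~_    = λ u v → Back u v ⊎ Back v u
    ; _~?_   = λ u v → Back? u v ⊎-dec Back? v u
    ; sym    = Sum.swap
    ; irrefl = λ { refl → Sum.[ (λ b → <-irrefl refl (Back⇒< b)) , (λ b → <-irrefl refl (Back⇒< b)) ] }
    }

  open Graph pathWithArcs using (_~_; neighbours)

  path~ : ∀ t → inject₁ t ~ suc t
  path~ t = inj₁ (step (cong suc (toℕ-inject₁ t)))

  arc~ : ∀ q → source q ~ target q
  arc~ q = inj₂ (arc q refl refl)

  backLabel : ∀ {u v} → Back u v → Fin (suc K)
  backLabel (step _)    = zero
  backLabel (arc q _ _) = suc (outLabel q)

  backLabel-injective : ∀ {u u′ v} (b : Back u v) (b′ : Back u′ v) →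
    backLabel b ≡ backLabel b′ → u ≡ u′
  backLabel-injective (step eq) (step eq′) _ =
    toℕ-injective (cong pred (trans eq (sym eq′)))
  backLabel-injective (arc q refl eq) (arc q′ refl eq′) labels =
    cong target (outLabel-injective (trans eq (sym eq′)) (Fin.suc-injective labels))

  forwardLabel : ∀ {u v} → Back u v → Fin (suc D)
  forwardLabel (step _)    = zero
  forwardLabel (arc q _ _) = suc (inLabel q)

  forwardLabel-injective : ∀ {u v v′} (b : Back u v) (b′ : Back u v′) →
    forwardLabel b ≡ forwardLabel b′ → v ≡ v′
  forwardLabel-injective (step eq) (step eq′) _ = toℕ-injective (trans (sym eq) eq′)
  forwardLabel-injective (arc q eq refl) (arc q′ eq′ refl) labels =
    cong source (inLabel-injective (trans eq (sym eq′)) (Fin.suc-injective labels))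

  label : ∀ {u v} → v ~ u → Fin (suc K) ⊎ Fin (suc D)
  label (inj₁ v→u) = inj₂ (forwardLabel v→u)
  label (inj₂ u→v) = inj₁ (backLabel u→v)

  label-injective : ∀ {u u′ v} (e : v ~ u) (e′ : v ~ u′) → label e ≡ label e′ → u ≡ u′
  label-injective (inj₁ b) (inj₁ b′) eq = forwardLabel-injective b b′ (inj₂-injective eq)
  label-injective (inj₂ b) (inj₂ b′) eq = backLabel-injective b b′ (inj₁-injective eq)

  maxDegree : MaxDegree≤ (suc K + suc D) pathWithArcs
  maxDegree v = ∣p∣≤-labels (neighbours v)
    (λ u∈ → join (suc K) (suc D) (label (∈-neighbours⁻ pathWithArcs u∈)))
    (λ u∈ u′∈ eq → label-injective (∈-neighbours⁻ pathWithArcs u∈) (∈-neighbours⁻ pathWithArcs u′∈)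
      (trans (sym (splitAt-join (suc K) (suc D) _))
        (trans (cong (splitAt (suc K)) eq) (splitAt-join (suc K) (suc D) _))))

  -- All neighbours of the last vertex of `S` within `S` come earlier, and `backLabel` separates
  -- them: one label for the path, `K` for the arcs.
  degenerate : Degenerate (suc K) pathWithArcs
  degenerate S nonempty = v , v∈S , ∣p∣≤-labels (neighbours v ∩ S)
    (λ u∈ → backLabel (back u∈))
    (λ u∈ u′∈ → backLabel-injective (back u∈) (back u′∈))
    where
    max = maximum S nonempty
    v   = proj₁ max
    v∈S = proj₁ (proj₂ max)
    back : ∀ {u} → u ∈ neighbours v ∩ S → Back u v
    back u∈ with u∈N , u∈S ← x∈p∩q⁻ (neighbours v) S u∈ | ∈-neighbours⁻ pathWithArcs u∈N
    ... | inj₁ v→u = contradiction (Back⇒< v→u) (≤⇒≯ (proj₂ (proj₂ max) u∈S))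
    ... | inj₂ u→v = u→v

-- Arcs determined by choices of free slots.

module ChosenArcs (T K : ℕ) where

  private
    D = suc K

  -- One number below `T !` for each colour: its factorial digits serve the `T` picks of that
  -- colour. In `digit` their order is reversed, so that a pick with `vertex q` equal to t has t + 1
  -- options.
  Choice : Set
  Choice = Fin ((T !) ^ K)

  vertex : Fin (T * K) → Fin T
  vertex q = quotient {T} K q

  colour : Fin (T * K) → Fin K
  colour q = remainder {T} K q

  toℕ-pick : ∀ q → toℕ q ≡ K * toℕ (vertex q) + toℕ (colour q)
  toℕ-pick q = trans (cong toℕ (sym (combine-remQuot {T} K q))) (toℕ-combine (vertex q) (colour q))

  toℕ-pick-< : ∀ q → toℕ q < K * suc (toℕ (vertex q))
  toℕ-pick-< q = begin-strict
    toℕ q                                       ≡⟨ toℕ-pick q ⟩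
    K * toℕ (vertex q) + toℕ (colour q)         <⟨ +-monoʳ-< (K * toℕ (vertex q)) (toℕ<n (colour q)) ⟩
    K * toℕ (vertex q) + K                      ≡⟨ trans (+-comm _ K) (sym (*-suc K _)) ⟩
    K * suc (toℕ (vertex q))                    ∎
    where open ≤-Reasoning

  vertex-mono : ∀ {p q} → toℕ p ≤ toℕ q → toℕ (vertex p) ≤ toℕ (vertex q)
  vertex-mono {p} {q} p≤q = s≤s⁻¹ (*-cancelˡ-< K _ _ (begin-strict
    K * toℕ (vertex p)          ≤⟨ m≤m+n _ _ ⟩
    K * toℕ (vertex p) + toℕ (colour p) ≡⟨ toℕ-pick p ⟨
    toℕ p                       ≤⟨ p≤q ⟩
    toℕ q                       <⟨ toℕ-pick-< q ⟩
    K * suc (toℕ (vertex q))    ∎))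
    where open ≤-Reasoning

  digit : Choice → Fin (T * K) → ℕ
  digit s q = factorialDigit (finToFun {T !} {K} s (colour q)) (opposite (vertex q))

  digit-≤ : ∀ s q → digit s q ≤ toℕ (vertex q)
  digit-≤ s q = subst (λ t → digit s q ≤ toℕ t) (opposite-involutive (vertex q))
    (factorialDigit-≤ (finToFun {T !} {K} s (colour q)) (opposite (vertex q)))

  digit-injective : ∀ {s s′} → digit s ≗ digit s′ → s ≡ s′
  digit-injective {s} {s′} eq = finToFun-injective {T !} {K} λ i →
    factorialDigit-injective {T} λ t → begin
      factorialDigit (finToFun s i) t           ≡⟨ digit-combine s i t ⟨
      digit s (combine (opposite t) i)          ≡⟨ eq (combine (opposite t) i) ⟩
      digit s′ (combine (opposite t) i)         ≡⟨ digit-combine s′ i t ⟩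
      factorialDigit (finToFun s′ i) t          ∎
    where
    open ≡-Reasoning
    digit-combine : ∀ s i t →
      digit s (combine (opposite t) i) ≡ factorialDigit (finToFun {T !} {K} s i) t
    digit-combine s i t = trans
      (cong (λ (u , j) → factorialDigit (finToFun {T !} {K} s j) (opposite u))
            (remQuot-combine {T} {K} (opposite t) i))
      (cong (factorialDigit (finToFun {T !} {K} s i)) (opposite-involutive t))

  -- The slots of vertex u are numbered u * D, …, u * D + K, so those below
  -- slotBound q belong to the vertices before suc (vertex q). At pick q the
  -- first toℕ q entries of the shuffled list of slots are the used ones.
  position : Choice → Fin (T * K) → ℕ
  position s q = toℕ q + digit s q

  slotBound : Fin (T * K) → ℕ
  slotBound q = suc (toℕ (vertex q)) * D

  -- With t = `vertex q`, fewer than K(t + 1) of the D(t + 1) slots on offer are used before pick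
  -- `q`. As `D` is `suc K`, more than t + 1 remain free, and the digit is at most t.
  position-< : ∀ s q → position s q < slotBound q
  position-< s q = begin-strict
    toℕ q + digit s q
      <⟨ +-mono-<-≤ (toℕ-pick-< q) (m≤n⇒m≤1+n (digit-≤ s q)) ⟩
    K * suc (toℕ (vertex q)) + suc (toℕ (vertex q))
      ≡⟨ trans (+-comm (K * suc (toℕ (vertex q))) _) (*-comm D (suc (toℕ (vertex q)))) ⟩
    suc (toℕ (vertex q)) * D ∎
    where open ≤-Reasoning

  slot : Choice → Fin (T * K) → ℕ
  slot s = shuffle 0 (position s)

  slot-injective : ∀ s → Injective _≡_ _≡_ (slot s)
  slot-injective s = shuffle-injective (position s) (λ q → m≤m+n (toℕ q) _)

  slot-< : ∀ s q → slot s q < slotBound q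
  slot-< s = shuffle-< (position s) slotBound (λ q → m≤m+n (toℕ q) _) (position-< s)
    (λ {p} {q} p≤q → *-monoˡ-≤ D (s≤s (vertex-mono {p} {q} p≤q)))

  slot-determines : ∀ {s s′} → slot s ≗ slot s′ → s ≡ s′
  slot-determines {s} {s′} eq = digit-injective λ q →
    +-cancelˡ-≡ (toℕ q) _ _ (shuffle-determines (position s) (position s′) eq q)

  source : Fin (T * K) → Fin (suc T)
  source q = suc (vertex q)

  slot/D< : ∀ s q → slot s q / D < suc (toℕ (vertex q))
  slot/D< s q = m<n*o⇒m/o<n (slot-< s q)

  target : Choice → Fin (T * K) → Fin (suc T)
  target s q = fromℕ< (<-≤-trans (slot/D< s q) (m≤n⇒m≤1+n (toℕ<n (vertex q))))

  toℕ-target : ∀ s q → toℕ (target s q) ≡ slot s q / D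
  toℕ-target s q = toℕ-fromℕ< _

  target<source : ∀ s q → target s q Fin.< source q
  target<source s q = subst (_< suc (toℕ (vertex q))) (sym (toℕ-target s q)) (slot/D< s q)

  inLabel : Choice → Fin (T * K) → Fin D
  inLabel s q = fromℕ< (m%n<n (slot s q) D)

  -- Quotient and remainder by `D` recover the slot. Taking `s′` to be `s` separates arcs with a
  -- common target; two different choices are compared when codes are decoded.
  target-inLabel⇒slot : ∀ {s s′ p q} →
    target s p ≡ target s′ q → inLabel s p ≡ inLabel s′ q → slot s p ≡ slot s′ q
  target-inLabel⇒slot {s} {s′} {p} {q} targets labels = begin
    slot s p                            ≡⟨ m≡m%n+[m/n]*n (slot s p) D ⟩
    slot s p % D + slot s p / D * D     ≡⟨ cong₂ (λ r t → r + t * D) %≡ /≡ ⟩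
    slot s′ q % D + slot s′ q / D * D   ≡⟨ m≡m%n+[m/n]*n (slot s′ q) D ⟨
    slot s′ q                           ∎
    where
    open ≡-Reasoning
    %≡ = fromℕ<-injective _ _ (m%n<n (slot s p) D) (m%n<n (slot s′ q) D) labels
    /≡ = trans (sym (toℕ-target s p)) (trans (cong toℕ targets) (toℕ-target s′ q))

  module H (s : Choice) = PathWithArcs source (target s) (target<source s)
    colour (λ eq → remQuot-injective {T} K (Fin.suc-injective eq))
    (inLabel s)
    (λ {p} {q} eq₁ eq₂ → slot-injective s (target-inLabel⇒slot {s} {s} {p} {q} eq₁ eq₂))

-- Codes of embeddings and their number.

funToFin-injective : {f g : Fin n → Fin m} → funToFin f ≡ funToFin g → f ≗ g
funToFin-injective {f = f} {g} eq i = trans (sym (finToFun-funToFin f i))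
  (trans (cong (λ - → finToFun - i) eq) (finToFun-funToFin g i))

module _ (Γ : Graph m) where

  open Graph Γ using (_~_; _~?_)

  index : Fin m → Fin m → ℕ
  index x = before (adjacency Γ x)

  index-< : ∀ {x y} → x ~ y → index x y < degree Γ x
  index-< {x} {y} x~y = subst (index x y <_) (sym (degree≡sum Γ x))
    (before-< (adjacency Γ x) y (𝟙-positive (x ~? y) x~y))

  degree-positive : ∀ {x y} → x ~ y → 0 < degree Γ x
  degree-positive x~y = ≤-<-trans z≤n (index-< x~y)

  index-injective : ∀ {x x′ y y′} → x ≡ x′ → x ~ y → x′ ~ y′ → index x y ≡ index x′ y′ → y ≡ y′
  index-injective {x} {y = y} {y′} refl x~y x~y′ =
    before-injective (adjacency Γ x) (𝟙-positive (x ~? y) x~y) (𝟙-positive (x ~? y′) x~y′)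

  walkCode : (Fin (suc n) → Fin m) → ℕ
  walkCode f = mixedRadix (λ t → degree Γ (f (inject₁ t))) (λ t → index (f (inject₁ t)) (f (suc t)))

  -- Each radix is the degree of the current vertex, known once that vertex is decoded; the lowest
  -- digit then gives the next vertex.
  walkCode-injective : (f g : Fin (suc n) → Fin m) →
    (∀ t → f (inject₁ t) ~ f (suc t)) → (∀ t → g (inject₁ t) ~ g (suc t)) →
    f zero ≡ g zero → walkCode f ≡ walkCode g → f ≗ g
  walkCode-injective         f g f~ g~ eq₀ eq zero    = eq₀
  walkCode-injective {suc n} f g f~ g~ eq₀ eq (suc t)
    with eq₁ , eq₊ ← leading-digit (cong (degree Γ) eq₀) (index-< (f~ zero)) (index-< (g~ zero)) eq =
    walkCode-injective (f ∘ suc) (g ∘ suc) (f~ ∘ suc) (g~ ∘ suc)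
      (index-injective eq₀ (f~ zero) (g~ zero) eq₁) eq₊ t

module Counting (T K : ℕ) (Γ : Graph m)
  (embed : ∀ s → ChosenArcs.H.pathWithArcs T K s ⊆ᴳ Γ)
  where

  open ChosenArcs T K
  open Graph Γ using (_~_; _~?_)

  private
    e+e = edgeCount Γ + edgeCount Γ

  f : Choice → Fin (suc T) → Fin m
  f s = proj₁ (embed s)

  f-injective : ∀ s → Injective _≡_ _≡_ (f s)
  f-injective s = proj₁ (proj₂ (embed s))

  f-path : ∀ s t → f s (inject₁ t) ~ f s (suc t)
  f-path s t = proj₂ (proj₂ (embed s)) (H.path~ s t)

  f-arc : ∀ s q → f s (source q) ~ f s (target s q)
  f-arc s q = proj₂ (proj₂ (embed s)) (H.arc~ s q)

  sum-degrees-≤ : (g : Fin n → Fin m) → Injective _≡_ _≡_ g → sum (degree Γ ∘ g) ≤ e+e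
  sum-degrees-≤ g g-injective = ≤-trans (sum-injection-≤ (degree Γ) g g-injective)
    (≤-reflexive (handshake Γ))

  -- The first `T` path vertices have distinct images, each of positive degree because of its
  -- successor.
  T≤2e : Choice → T ≤ e+e
  T≤2e s = ≤-trans (n≤sum (λ t → degree Γ (f s (inject₁ t))) λ t → degree-positive Γ (f-path s t))
    (sum-degrees-≤ (f s ∘ inject₁) (inject₁-injective ∘ f-injective s))

  arcDigit : Choice → Fin K → Fin T → ℕ
  arcDigit s i t = index Γ (f s (suc t)) (f s (target s (combine t i)))

  f-arc-combine : ∀ s i t → f s (suc t) ~ f s (target s (combine t i))
  f-arc-combine s i t =
    subst (λ u → f s (suc u) ~ f s (target s (combine t i)))
      (cong proj₁ (remQuot-combine {T} {K} t i)) (f-arc s (combine t i))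

  -- One numeral per colour, so that its radices are the degrees of distinct vertices and their
  -- product obeys the same bound as for the walk.
  arcCode : Choice → Fin K → ℕ
  arcCode s i = mixedRadix (λ t → degree Γ (f s (suc t))) (arcDigit s i)

  module _ (b N : ℕ) .{{_ : NonZero b}} (2e≤N*b : e+e ≤ N * b) where

    M : ℕ
    M = b ^ T * 2 ^ N

    product-degrees-≤ : (g : Fin T → Fin m) → Injective _≡_ _≡_ g → product (degree Γ ∘ g) ≤ M
    product-degrees-≤ g g-injective = product≤-of-sum≤ {m = N} (degree Γ ∘ g) b
      (≤-trans (sum-degrees-≤ g g-injective) 2e≤N*b)

    walkCode-< : ∀ s → walkCode Γ (f s) < M
    walkCode-< s = <-≤-trans
      (mixedRadix-< _ _ (λ t → index-< Γ (f-path s t)))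
      (product-degrees-≤ (f s ∘ inject₁) (inject₁-injective ∘ f-injective s))

    arcCode-< : ∀ s i → arcCode s i < M
    arcCode-< s i = <-≤-trans
      (mixedRadix-< _ _ (λ t → index-< Γ (f-arc-combine s i t)))
      (product-degrees-≤ (f s ∘ suc) (Fin.suc-injective ∘ f-injective s))

    module _ .{{_ : NonZero T}} where

      start-~ : ∀ s → ∃[ y ] f s zero ~ y
      start-~ s = go (f s) (f-path s)
        where
        go : ∀ {T} .{{_ : NonZero T}} (g : Fin (suc T) → Fin m) →
          (∀ t → g (inject₁ t) ~ g (suc t)) → ∃[ y ] g zero ~ y
        go {suc T} g g~ = g (suc zero) , g~ zero

      -- The number `m` of vertices of `Γ` is not bounded in terms of its edges, so the start is
      -- numbered by prefix sums of degrees.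
      startCode-< : ∀ s → before (degree Γ) (f s zero) < e+e
      startCode-< s = <-≤-trans
        (before-< (degree Γ) (f s zero) (degree-positive Γ (proj₂ (start-~ s))))
        (≤-reflexive (handshake Γ))

      code : Choice → Fin (e+e * (M * (M ^ K * suc K ^ (T * K))))
      code s = combine (fromℕ< (startCode-< s)) (combine (fromℕ< (walkCode-< s))
        (combine (funToFin (λ i → fromℕ< (arcCode-< s i))) (funToFin (inLabel s))))

      -- The start and the walk determine the embedding. Only then are the radices of the arc digits
      -- known; these give the targets, which together with the in-labels give the slots and hence
      -- the choice.
      code-injective : Injective _≡_ _≡_ code
      code-injective {s} {s′} eq = slot-determines λ q →
        target-inLabel⇒slot {s} {s′} {q} {q} (targets≡ q) (inLabels≡ q)
        where
        eqs₁ = combine-injective (fromℕ< (startCode-< s)) _ (fromℕ< (startCode-< s′)) _ eq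
        eqs₂ = combine-injective (fromℕ< (walkCode-< s)) _ (fromℕ< (walkCode-< s′)) _ (proj₂ eqs₁)
        eqs₃ = combine-injective (funToFin (λ i → fromℕ< (arcCode-< s i))) (funToFin (inLabel s))
                 (funToFin (λ i → fromℕ< (arcCode-< s′ i))) (funToFin (inLabel s′)) (proj₂ eqs₂)
        f0≡ : f s zero ≡ f s′ zero
        f0≡ = before-injective (degree Γ)
          (degree-positive Γ (proj₂ (start-~ s))) (degree-positive Γ (proj₂ (start-~ s′)))
          (fromℕ<-injective _ _ (startCode-< s) (startCode-< s′) (proj₁ eqs₁))
        f≗ : f s ≗ f s′
        f≗ = walkCode-injective Γ (f s) (f s′) (f-path s) (f-path s′) f0≡
          (fromℕ<-injective _ _ (walkCode-< s) (walkCode-< s′) (proj₁ eqs₂))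
        arcDigits≡ : ∀ i → arcDigit s i ≗ arcDigit s′ i
        arcDigits≡ i = mixedRadix-injective (λ t → cong (degree Γ) (f≗ (suc t)))
          (λ t → index-< Γ (f-arc-combine s i t)) (λ t → index-< Γ (f-arc-combine s′ i t))
          (fromℕ<-injective _ _ (arcCode-< s i) (arcCode-< s′ i)
            (funToFin-injective (proj₁ eqs₃) i))
        targets-combine≡ : ∀ i t → target s (combine t i) ≡ target s′ (combine t i)
        -- The images of the targets agree in `Γ`. As the two embeddings coincide, both images can
        -- be pulled back along `f s`.
        targets-combine≡ i t = f-injective s (trans
          (index-injective Γ (f≗ (suc t)) (f-arc-combine s i t) (f-arc-combine s′ i t) (arcDigits≡ i t))
          (sym (f≗ _)))
        targets≡ : target s ≗ target s′
        targets≡ q = subst (λ p → target s p ≡ target s′ p) (combine-remQuot {T} K q)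
          (targets-combine≡ (colour q) (vertex q))
        inLabels≡ : inLabel s ≗ inLabel s′
        inLabels≡ = funToFin-injective (proj₂ eqs₃)

      choices≤codes : (T !) ^ K ≤ e+e * (M * (M ^ K * suc K ^ (T * K)))
      choices≤codes = injective⇒≤ code-injective

-- Comparing the number of choices with the number of codes.

^-distribʳ-* : ∀ m n k → (m * n) ^ k ≡ m ^ k * n ^ k
^-distribʳ-* m n zero    = refl
^-distribʳ-* m n (suc k) =
  trans (cong (m * n *_) (^-distribʳ-* m n k)) ([m*n]*[o*p]≡[m*o]*[n*p] m n (m ^ k) (n ^ k))

module _ (T K e b : ℕ) .{{_ : NonZero T}} .{{_ : NonZero b}} where

  private
    N = suc T
    D = suc K
    P = D * T
    M = b ^ T * 2 ^ T

    instance
      P≢0 : NonZero P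
      P≢0 = m*n≢0 D T

      bD≢0 : NonZero (b * D)
      bD≢0 = m*n≢0 b D

    regroup-250 : ∀ D b T → 250 * D * b * T ≡ 250 * D * (T * b)
    regroup-250 = solve-∀

    regroup-1000 : ∀ D e → 250 * D * (4 * e) ≡ 1000 * D * e
    regroup-1000 = solve-∀

    regroup-bD : ∀ b D → 250 * D * b ≡ 250 * (b * D)
    regroup-bD = solve-∀

    regroup-128 : ∀ b D → 4 * (4 * (4 * (b * 2 * D))) ≡ 128 * (b * D)
    regroup-128 = solve-∀

    N≤2T : N ≤ 2 * T
    N≤2T = ≤-trans (+-monoˡ-≤ T (>-nonZero⁻¹ T)) (≤-reflexive (cong (T +_) (sym (+-identityʳ T))))

  module _ (e-small : (1000 * D * e) ^ D < N ^ (K + D)) (T*b≤4*e : T * b ≤ 4 * e) where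

    -- A crude consequence of `e-small`, sufficient to absorb the number of start vertices into
    -- `4 ^ P`.
    edges<N*N : 1000 * D * e < N * N
    edges<N*N = ≰⇒> λ N*N≤ → <⇒≱ e-small (begin
      N ^ (K + D)         ≤⟨ ^-monoʳ-≤ N (n≤1+n (K + D)) ⟩
      N ^ (D + D)         ≡⟨ ^-distribˡ-+-* N D D ⟩
      N ^ D * N ^ D       ≡⟨ ^-distribʳ-* N N D ⟨
      (N * N) ^ D         ≤⟨ ^-monoˡ-≤ D N*N≤ ⟩
      (1000 * D * e) ^ D  ∎)
      where open ≤-Reasoning

    e+e≤4^P : e + e ≤ 4 ^ P
    e+e≤4^P = begin
      e + e              ≡⟨ cong (e +_) (+-identityʳ e) ⟨
      2 * e              ≤⟨ *-monoˡ-≤ e (≤-trans (s≤s (s≤s z≤n)) (m≤m*n 1000 D)) ⟩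
      1000 * D * e       ≤⟨ <⇒≤ edges<N*N ⟩
      -- `N` is `suc T`, so the strict inequality at `T` is exactly `N ≤ 2 ^ T`.
      N * N              ≤⟨ *-mono-≤ (n<2^n T) (n<2^n T) ⟩
      2 ^ T * 2 ^ T      ≡⟨ ^-distribʳ-* 2 2 T ⟨
      4 ^ T              ≤⟨ ^-monoʳ-≤ 4 (m≤n*m T D) ⟩
      4 ^ P              ∎
      where open ≤-Reasoning

    -- After multiplication by `T ^ D`, the bound `T * b ≤ 4 * e` turns 250 into the 1000 of
    -- `e-small`. Replacing `N` by `2 * T` costs at most `4 ^ D`.
    250Db^D≤ : (250 * D * b) ^ D ≤ 4 ^ D * T ^ K
    250Db^D≤ = *-cancelʳ-≤ _ _ (T ^ D) {{m^n≢0 T D}} (begin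
      (250 * D * b) ^ D * T ^ D        ≡⟨ ^-distribʳ-* (250 * D * b) T D ⟨
      (250 * D * b * T) ^ D            ≡⟨ cong (_^ D) (regroup-250 D b T) ⟩
      (250 * D * (T * b)) ^ D          ≤⟨ ^-monoˡ-≤ D (*-monoʳ-≤ (250 * D) T*b≤4*e) ⟩
      (250 * D * (4 * e)) ^ D          ≡⟨ cong (_^ D) (regroup-1000 D e) ⟩
      (1000 * D * e) ^ D               ≤⟨ <⇒≤ e-small ⟩
      N ^ (K + D)                      ≤⟨ ^-monoˡ-≤ (K + D) N≤2T ⟩
      (2 * T) ^ (K + D)                ≡⟨ ^-distribʳ-* 2 T (K + D) ⟩
      2 ^ (K + D) * T ^ (K + D)        ≡⟨ cong₂ _*_ (^-distribˡ-+-* 2 K D) (^-distribˡ-+-* T K D) ⟩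
      2 ^ K * 2 ^ D * (T ^ K * T ^ D)  ≤⟨ *-monoˡ-≤ _ (*-monoˡ-≤ (2 ^ D) (^-monoʳ-≤ 2 (n≤1+n K))) ⟩
      2 ^ D * 2 ^ D * (T ^ K * T ^ D)  ≡⟨ cong (_* (T ^ K * T ^ D)) (^-distribʳ-* 2 2 D) ⟨
      4 ^ D * (T ^ K * T ^ D)          ≡⟨ *-assoc (4 ^ D) (T ^ K) (T ^ D) ⟨
      4 ^ D * T ^ K * T ^ D            ∎)
      where open ≤-Reasoning

    -- Every loss is a `P`-th power: a 4 from `250Db^D≤`, a 4 from the factorial, a 4 from the start
    -- vertex, a 2 from the product bound in `M`, and `D` from the in-labels. Together they give
    -- 128, below 250.
    too-few-codes : ¬ ((T !) ^ K ≤ (e + e) * (M * (M ^ K * D ^ (T * K))))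
    too-few-codes choices≤codes = <⇒≱ (^-monoˡ-< P 128bD<250bD) (begin
      (250 * D * b) ^ P
        ≡⟨ ^-*-assoc (250 * D * b) D T ⟨
      ((250 * D * b) ^ D) ^ T
        ≤⟨ ^-monoˡ-≤ T 250Db^D≤ ⟩
      (4 ^ D * T ^ K) ^ T
        ≡⟨ trans (^-distribʳ-* (4 ^ D) (T ^ K) T) (cong (_* (T ^ K) ^ T) (^-*-assoc 4 D T)) ⟩
      4 ^ P * (T ^ K) ^ T
        ≤⟨ *-monoʳ-≤ (4 ^ P) T^KT≤ ⟩
      4 ^ P * (4 ^ P * (4 ^ P * ((b * 2) ^ P * D ^ P)))
        ≡⟨ collect ⟩
      (4 * (4 * (4 * (b * 2 * D)))) ^ P ∎)
      where
      open ≤-Reasoning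

      128bD<250bD : 4 * (4 * (4 * (b * 2 * D))) < 250 * D * b
      128bD<250bD = subst₂ _<_ (sym (regroup-128 b D)) (sym (regroup-bD b D))
        (*-monoˡ-< (b * D) (m≤m+n 129 121))

      collect : 4 ^ P * (4 ^ P * (4 ^ P * ((b * 2) ^ P * D ^ P))) ≡
                (4 * (4 * (4 * (b * 2 * D)))) ^ P
      collect = sym (
        trans (^-distribʳ-* 4 _ P) (cong (4 ^ P *_) (
        trans (^-distribʳ-* 4 _ P) (cong (4 ^ P *_) (
        trans (^-distribʳ-* 4 _ P) (cong (4 ^ P *_) (^-distribʳ-* (b * 2) D P)))))))

      TK≤P : T * K ≤ P
      TK≤P = ≤-trans (≤-reflexive (*-comm T K)) (*-monoˡ-≤ T (n≤1+n K))

      M^D≡ : M ^ D ≡ (b * 2) ^ P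
      M^D≡ = trans (cong (_^ D) (sym (^-distribʳ-* b 2 T)))
        (trans (^-*-assoc (b * 2) T D) (cong ((b * 2) ^_) (*-comm T D)))

      codes≤ : (e + e) * (M * (M ^ K * D ^ (T * K))) ≤ 4 ^ P * ((b * 2) ^ P * D ^ P)
      codes≤ = *-mono-≤ e+e≤4^P (begin
        M * (M ^ K * D ^ (T * K))  ≡⟨ *-assoc M (M ^ K) _ ⟨
        M ^ D * D ^ (T * K)        ≤⟨ *-mono-≤ (≤-reflexive M^D≡) (^-monoʳ-≤ D TK≤P) ⟩
        (b * 2) ^ P * D ^ P        ∎)

      T^KT≤ : (T ^ K) ^ T ≤ 4 ^ P * (4 ^ P * ((b * 2) ^ P * D ^ P))
      T^KT≤ = begin
        (T ^ K) ^ T             ≡⟨ trans (^-*-assoc T K T) (trans (cong (T ^_) (*-comm K T)) (sym (^-*-assoc T T K))) ⟩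
        (T ^ T) ^ K             ≤⟨ ^-monoˡ-≤ K (n^n≤4^n*n! T) ⟩
        (4 ^ T * T !) ^ K       ≡⟨ trans (^-distribʳ-* (4 ^ T) (T !) K) (cong (_* (T !) ^ K) (^-*-assoc 4 T K)) ⟩
        4 ^ (T * K) * (T !) ^ K ≤⟨ *-mono-≤ (^-monoʳ-≤ 4 TK≤P) (≤-trans choices≤codes codes≤) ⟩
        4 ^ P * (4 ^ P * ((b * 2) ^ P * D ^ P)) ∎

-- The edge bound for universal graphs.

theorem1p2 : ∀ (D : ℕ) .{{_ : NonZero D}} →
    ∃[ n₀ ] (∀ (n : ℕ) → n ≥ n₀ →
    ∀ (m : ℕ) (Γ : Graph m) →
    (∀ (H : Graph n) → Degenerate D H → MaxDegree≤ (2 * D + 1) H → H ⊆ᴳ Γ) →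
    n ^[ (2 * D ∸ 1) / D ]≤ (1000 * D * edgeCount Γ))
theorem1p2 (suc K) = 2 , λ where
    (suc zero) (s≤s ())
    -- The path on `n = suc T` vertices has `T` edges, and `n ≥ 2` makes `T` nonzero.
    (suc T@(suc _)) _ m Γ universal → ≮⇒≥ λ e-small →
      let
        D = suc K
        e = edgeCount Γ
        -- Just above the average 2e/T, so that `T * b` lies between 2e and 4e; the upper bound uses
        -- `T≤2e` to absorb the added `T`.
        b = suc ((e + e) / T)
        embed = λ s → universal (ChosenArcs.H.pathWithArcs T K s) (ChosenArcs.H.degenerate T K s)
          (subst (λ k → MaxDegree≤ k (ChosenArcs.H.pathWithArcs T K s)) (labels K)
            (ChosenArcs.H.maxDegree T K s))
        -- Any choice will do here; choice number 0 exists because `(T !) ^ K` is positive.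
        T≤2e = Counting.T≤2e T K Γ embed (fromℕ< (m^n>0 (T !) {{T !≢0}} K))
        2e≤T*b : e + e ≤ T * b
        2e≤T*b = begin
          e + e                              ≡⟨ m≡m%n+[m/n]*n (e + e) T ⟩
          (e + e) % T + (e + e) / T * T      ≤⟨ +-monoˡ-≤ _ (m%n≤n (e + e) T) ⟩
          T + (e + e) / T * T                ≡⟨ *-comm b T ⟩
          T * b                              ∎
        T*b≤4*e : T * b ≤ 4 * e
        T*b≤4*e = begin
          T * b                              ≡⟨ *-comm T b ⟩
          T + (e + e) / T * T                ≤⟨ +-mono-≤ T≤2e (m/n*n≤m (e + e) T) ⟩
          (e + e) + (e + e)                  ≡⟨ quadruple e ⟩
          4 * e                              ∎
      in too-few-codes T K e b
           (subst (λ k → (1000 * D * e) ^ D < suc T ^ k) (cong (K +_) (+-identityʳ D)) e-small)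
           T*b≤4*e
           (Counting.choices≤codes T K Γ embed b T 2e≤T*b)
  where
  open ≤-Reasoning
  labels : ∀ K → suc K + suc (suc K) ≡ 2 * suc K + 1
  labels = solve-∀
  quadruple : ∀ e → e + e + (e + e) ≡ 4 * e
  quadruple = solve-∀
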